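{- Let $\mathcal{X}$ be a homogeneous coherent configuration on $n$ points with indistinguishing number $c$ and maximum valency $k$. Suppose that $2c(k-1)<n$. Then every one point extension of $\mathcal{X}$ is $1$-regular. In particular, $b(\mathcal{X})\le 2$.
   Context: Let $\Omega$ be a finite set. For $r\subseteq\Omega\times\Omega$ and $\alpha\in\Omega$ put $r^*=\{(\beta,\alpha):(\alpha,\beta)\in r\}$ and $\alpha r=\{\beta:(\alpha,\beta)\in r\}$; $1_\Omega$ is the diagonal of $\Omega\times\Omega$. A coherent configuration on $\Omega$ is a pair $\mathcal{X}=(\Omega,S)$, where $S$ is a partition of $\Omega\times\Omega$ such that $1_\Omega$ is a union of elements of $S$, $s^*\in S$ for all $s\in S$, and for all $r,s,t\in S$ the intersection number $c_{rs}^t=|\alpha r\cap\beta s^*|$ does not depend on $(\alpha,\beta)\in t$. The elements of $S$ are the basis relations, unions of them are the relations. $\mathcal{X}$ is homogeneous if $1_\Omega\in S$; then the valency $n_s=|\alpha s|$ of $s\in S$ does not depend on $\alpha\in\Omega$, and the maximum valency is $k=\max_{s\in S}n_s$. The indistinguishing number of $r\in S$ is $c(r)=\sum_{s\in S}c_{ss^*}^r$, and the indistinguishing number of $\mathcal{X}$ is $c=\max\{c(r): r\in S,\ r\neq 1_\Omega\}$. A point $\alpha$ of a coherent configuration is regular if $|\alpha r|\le 1$ for all its basis relations $r$; a coherent configuration is $1$-regular if it has a regular point. It is complete if all its basis relations are singletons. For coherent configurations on the same set, $\mathcal{X}\le\mathcal{X}'$ means that every relation of $\mathcal{X}$ is a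 relation of $\mathcal{X}'$. For points $\alpha,\beta,\ldots\in\Omega$ the point extension $\mathcal{X}_{\alpha,\beta,\ldots}$ is the smallest coherent configuration on $\Omega$ that is $\ge\mathcal{X}$ and has $\{(\alpha,\alpha)\},\{(\beta,\beta)\},\ldots$ as relations; a one point extension is $\mathcal{X}_\alpha$ with $\alpha\in\Omega$. A set $\{\alpha,\beta,\ldots\}$ is a base of $\mathcal{X}$ if $\mathcal{X}_{\alpha,\beta,\ldots}$ is complete; $b(\mathcal{X})$ is the smallest cardinality of a base. -}

module Defs where

open import Data.Bool.Base using (Bool; true; false; if_then_else_)
import Data.Bool.Properties as Bool
open import Data.Fin.Base using (Fin; zero; suc; combine; remQuot)
open import Data.Fin.Properties using (_≟_; all?; any?; remQuot-combine; combine-remQuot; combine-injective)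
open import Data.Fin.Subset using (Subset; _∈_; _∩_; ⁅_⁆; ∣_∣; ⊤; ⊥; _⊂_; _⊆_)
import Data.Fin.Subset as Subset
open import Data.Fin.Subset.Induction using (⊂-wellFounded)
open import Data.Fin.Subset.Properties
  using (_∈?_; x∈⁅x⁆; x∈⁅y⁆⇒x≡y; x∈p∩q⁺; x∈p∩q⁻; ⊆-antisym; anySubset?; ∈⊤; nonempty?; Empty-unique; ∣⊥∣≡0; ∉⊥; x∈p⇒∣p-x∣<∣p∣)
open import Data.List.Base as List using (List; allFin; filter; cartesianProductWith; deduplicate)
open import Data.List.Extrema.Nat using (max)
open import Data.List.Membership.Propositional as List using ()
open import Data.List.Membership.Propositional.Properties
  using (∈-cartesianProductWith⁺; ∈-cartesianProductWith⁻; ∈-allFin; ∈-deduplicate⁺; ∈-deduplicate⁻; ∈-lookup)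
open import Data.List.Membership.Setoid.Properties using (index-injective)
import Data.List.Relation.Unary.All as All
open import Data.List.Relation.Unary.AllPairs using (_∷_)
open import Data.List.Relation.Unary.Any using (index)
open import Data.List.Relation.Unary.Any.Properties using (lookup-index)
open import Data.List.Relation.Unary.Unique.Propositional using (Unique)
open import Data.List.Relation.Unary.Unique.DecPropositional.Properties using (deduplicate-!)
open import Data.Maybe.Base using (Maybe; just; nothing)
import Data.Maybe.Properties as Maybe
open import Data.Nat.Base using (ℕ; zero; suc; _+_; _*_; _≤_; _<_)
import Data.Nat.ListAction as ListAction
open import Data.Nat.Induction using (<-wellFounded)
import Data.Nat.Properties as ℕ
open import Algebra.Properties.Semiring.Sum ℕ.+-*-semiring using (sum; ∑-comm; sum-cong-≗; *-distribˡ-sum)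
open import Data.Product.Base using (∃; ∃₂; _×_; _,_; proj₁; proj₂)
import Data.Product.Properties as Product
open import Data.Vec.Base using (Vec; lookup; tabulate)
import Data.Vec.Properties as Vec
open import Function.Base using (_∘_)
open import Function.Bundles using (_⇔_; mk⇔; Equivalence)
open import Induction.WellFounded using (Acc; acc)
open import Relation.Binary.Definitions using (DecidableEquality)
open import Relation.Binary.PropositionalEquality
  using (_≡_; refl; sym; trans; cong; cong₂; subst; setoid; module ≡-Reasoning)
open import Relation.Nullary.Decidable using (Dec; yes; no; does; map′; _×-dec_; ¬?; dec-true; decidable-stable)
open import Relation.Nullary.Negation using (¬_; contradiction)
open import Relation.Unary using (Decidable)

open Equivalence using (to; from)

-- A binary relation r on Ω = Fin n; the value r α is the set αr.

BinRel : ℕ → Set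
BinRel n = Fin n → Subset n

module _ {n : ℕ} where

  infix 4 _≐_

  _≐_ : BinRel n → BinRel n → Set
  r ≐ s = ∀ α → r α ≡ s α

  converse : BinRel n → BinRel n
  converse r β = tabulate λ α → lookup (r α) β

  diagonal : BinRel n
  diagonal α = ⁅ α ⁆

  singleton : Fin n → Fin n → BinRel n
  singleton α β γ = if does (γ ≟ α) then ⁅ β ⁆ else ⊥

-- A partition of Ω × Ω with classes indexed by Fin rank, given by the map
-- sending a pair to the index of its class.

record Partition (n : ℕ) : Set where
  field
    rank     : ℕ
    colour   : Fin n → Fin n → Fin rank
    nonempty : ∀ s → ∃₂ λ α β → colour α β ≡ s

  basis : Fin rank → BinRel n
  basis s α = tabulate λ β → does (colour α β ≟ s)

  IsRelation : BinRel n → Set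
  IsRelation r = ∃ λ (T : Subset rank) → ∀ α β → β ∈ r α ⇔ colour α β ∈ T

  -- αr ∩ βs*
  triangles : Fin rank → Fin rank → Fin n → Fin n → Subset n
  triangles r s α β = basis r α ∩ converse (basis s) β

record CoherentConfiguration (n : ℕ) : Set where
  field
    partition : Partition n

  open Partition partition public

  field
    diagonal-relation : IsRelation diagonal
    converse-basis    : ∀ s → ∃ λ s* → basis s* ≐ converse (basis s)
    coherent          : ∀ r s t α β γ δ → β ∈ basis t α → δ ∈ basis t γ →
                        ∣ triangles r s α β ∣ ≡ ∣ triangles r s γ δ ∣

  infix 25 _*ᵇ

  _*ᵇ : Fin rank → Fin rank
  s *ᵇ = proj₁ (converse-basis s)

  intersectionNumber : Fin rank → Fin rank → Fin rank → ℕ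
  intersectionNumber r s t =
    let α , β , _ = nonempty t in ∣ triangles r s α β ∣

module _ {n : ℕ} (X : CoherentConfiguration n) where
  open CoherentConfiguration X

  IsHomogeneous : Set
  IsHomogeneous = ∃ λ s → basis s ≐ diagonal

  -- |αs| for a point α with αs nonempty; in the homogeneous case every point
  -- gives the same value, see valency-unique.

  valency : Fin rank → ℕ
  valency s = ∣ basis s (proj₁ (nonempty s)) ∣

  -- The maxima below are 0 when taken over the empty set: for n = 0, and for
  -- indistinguishingNumber also when the diagonal is the only basis relation
  -- (n = 1).

  maxValency : ℕ
  maxValency = max 0 (List.map valency (allFin rank))

  relationIndistinguishingNumber : Fin rank → ℕ
  relationIndistinguishingNumber r =
    ListAction.sum (List.map (λ s → intersectionNumber s (s *ᵇ) r) (allFin rank))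

  indistinguishingNumber : IsHomogeneous → ℕ
  indistinguishingNumber (1Ω , _) =
    max 0 (List.map relationIndistinguishingNumber
                    (filter (λ r → ¬? (r ≟ 1Ω)) (allFin rank)))

  IsRegularPoint : Fin n → Set
  IsRegularPoint α = ∀ r → ∣ basis r α ∣ ≤ 1

  IsOneRegular : Set
  IsOneRegular = ∃ IsRegularPoint

  IsComplete : Set
  IsComplete = ∀ r → ∃₂ λ α β → basis r ≐ singleton α β

  Fixes : Subset n → Set
  Fixes A = ∀ α → α ∈ A → IsRelation (singleton α α)

infix 4 _≼_

_≼_ : ∀ {n} → CoherentConfiguration n → CoherentConfiguration n → Set
X ≼ Y = ∀ r → X.IsRelation r → Y.IsRelation r
  where module X = CoherentConfiguration X
        module Y = CoherentConfiguration Y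

record IsPointExtension {n} (X : CoherentConfiguration n) (A : Subset n)
                        (Y : CoherentConfiguration n) : Set where
  field
    extends  : X ≼ Y
    fixes    : Fixes Y A
    smallest : ∀ Z → X ≼ Z → Fixes Z A → Y ≼ Z

∈-tabulate : ∀ {n} {P : Fin n → Set} (P? : Decidable P) {x} →
             x ∈ tabulate (does ∘ P?) ⇔ P x
∈-tabulate {P = P} P? {x} = mk⇔ fwd bwd
  where
  fwd : x ∈ tabulate (does ∘ P?) → P x
  fwd m with P? x | trans (sym (Vec.lookup∘tabulate (does ∘ P?) x)) (Vec.[]=⇒lookup m)
  ... | yes p | _  = p
  ... | no  _ | ()
  bwd : P x → x ∈ tabulate (does ∘ P?)
  bwd p = Vec.lookup⇒[]= x _ (trans (Vec.lookup∘tabulate (does ∘ P?) x) (dec-true (P? x) p))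

∈-converse : ∀ {n} (r : BinRel n) {α β} → α ∈ converse r β ⇔ β ∈ r α
∈-converse r {α} {β} = mk⇔
  (λ m → Vec.lookup⇒[]= β _ (trans (sym (Vec.lookup∘tabulate _ α)) (Vec.[]=⇒lookup m)))
  (λ m → Vec.lookup⇒[]= α _ (trans (Vec.lookup∘tabulate _ α) (Vec.[]=⇒lookup m)))

∈-singleton : ∀ {n} {α β γ δ : Fin n} → δ ∈ singleton α β γ ⇔ (γ ≡ α × δ ≡ β)
∈-singleton {α = α} {β} {γ} {δ} = mk⇔ fwd bwd
  where
  fwd : δ ∈ singleton α β γ → γ ≡ α × δ ≡ β
  fwd m with γ ≟ α
  ... | yes e = e , x∈⁅y⁆⇒x≡y β m
  ... | no  _ = contradiction m ∉⊥
  bwd : γ ≡ α × δ ≡ β → δ ∈ singleton α β γ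
  bwd (refl , refl) rewrite dec-true (γ ≟ γ) refl = x∈⁅x⁆ δ

module _ {n : ℕ} (P : Partition n) where
  open Partition P

  ∈-basis : ∀ {s α β} → β ∈ basis s α ⇔ colour α β ≡ s
  ∈-basis {s} {α} = ∈-tabulate (λ β → colour α β ≟ s)

  ∈-triangles : ∀ {r s α β γ} → γ ∈ triangles r s α β ⇔ (colour α γ ≡ r × colour γ β ≡ s)
  ∈-triangles {r} {s} {α} {β} = mk⇔
    (λ m → let p , q = x∈p∩q⁻ (basis r α) (converse (basis s) β) m
           in to ∈-basis p , to ∈-basis (to (∈-converse (basis s)) q))
    (λ (p , q) → x∈p∩q⁺ (from ∈-basis p , from (∈-converse (basis s)) (from ∈-basis q)))

  Closed : BinRel n → Set
  Closed r = ∀ {α β γ δ} → colour α β ≡ colour γ δ → β ∈ r α → δ ∈ r γ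

  relation⇒closed : ∀ {r} → IsRelation r → Closed r
  relation⇒closed (T , h) {α} {β} {γ} {δ} e m =
    from (h γ δ) (subst (_∈ T) e (to (h α β) m))

  closed⇒relation : ∀ {r} → Closed r → IsRelation r
  closed⇒relation {r} h = T , λ α β → mk⇔
      (λ m → from ∈-T (h (sym (proj₂ (proj₂ (nonempty (colour α β))))) m))
      (λ m → h (proj₂ (proj₂ (nonempty (colour α β)))) (to ∈-T m))
    where
    P? : ∀ s → Dec (proj₁ (proj₂ (nonempty s)) ∈ r (proj₁ (nonempty s)))
    P? s = proj₁ (proj₂ (nonempty s)) ∈? r (proj₁ (nonempty s))
    T = tabulate (does ∘ P?)
    ∈-T : ∀ {s} → s ∈ T ⇔ proj₁ (proj₂ (nonempty s)) ∈ r (proj₁ (nonempty s))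
    ∈-T = ∈-tabulate P?

  basis-relation : ∀ s → IsRelation (basis s)
  basis-relation s = closed⇒relation λ e m → from ∈-basis (trans (sym e) (to ∈-basis m))

valency-unique : ∀ {n} (X : CoherentConfiguration n) → IsHomogeneous X →
                 ∀ s α → ∣ CoherentConfiguration.basis X s α ∣ ≡ valency X s
valency-unique X (1Ω , h) s α =
  trans (sym (cong ∣_∣ (tri≡ α))) (trans (X.coherent s s* 1Ω α α β β (loop α) (loop β)) (cong ∣_∣ (tri≡ β)))
  where
  module X = CoherentConfiguration X
  s* = proj₁ (X.converse-basis s)
  β = proj₁ (X.nonempty s)
  loop : ∀ γ → γ ∈ X.basis 1Ω γ
  loop γ = subst (γ ∈_) (sym (h γ)) (x∈⁅x⁆ γ)
  tri≡ : ∀ γ → X.triangles s s* γ γ ≡ X.basis s γ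
  tri≡ γ = ⊆-antisym
    (λ m → proj₁ (x∈p∩q⁻ (X.basis s γ) _ m))
    (λ {δ} m → x∈p∩q⁺ (m , from (∈-converse (X.basis s*))
      (subst (γ ∈_) (sym (proj₂ (X.converse-basis s) δ)) (from (∈-converse (X.basis s)) m))))

-- Existence of point extensions, by Weisfeiler–Leman refinement

Refines : ∀ {n} → Partition n → Partition n → Set
Refines Q P = ∀ {α β γ δ} → Q.colour α β ≡ Q.colour γ δ → P.colour α β ≡ P.colour γ δ
  where module Q = Partition Q
        module P = Partition P

≼⇒refines : ∀ {n} (X Y : CoherentConfiguration n) → X ≼ Y →
            Refines (CoherentConfiguration.partition Y) (CoherentConfiguration.partition X)
≼⇒refines X Y X≼Y {α} {β} e =
  sym (to (∈-basis X.partition)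
    (relation⇒closed Y.partition (X≼Y _ (basis-relation X.partition (X.colour α β))) e
      (from (∈-basis X.partition) refl)))
  where module X = CoherentConfiguration X
        module Y = CoherentConfiguration Y

refines⇒≼ : ∀ {n} (X Y : CoherentConfiguration n) →
            Refines (CoherentConfiguration.partition Y) (CoherentConfiguration.partition X) → X ≼ Y
refines⇒≼ X Y h r R =
  closed⇒relation (CoherentConfiguration.partition Y) λ e →
    relation⇒closed (CoherentConfiguration.partition X) R (h e)

-- The partition of Ω × Ω into the nonempty fibres of f.

module Fibres {n : ℕ} {T : Set} (_≟T_ : DecidableEquality T) (f : Fin n → Fin n → T) where

  private
    lookup-injective : ∀ {xs : List T} → Unique xs →
                       ∀ i j → List.lookup xs i ≡ List.lookup xs j → i ≡ j
    lookup-injective (_ ∷ _)  zero    zero    _ = refl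
    lookup-injective (a ∷ _)  zero    (suc j) e = contradiction e (All.lookup a (∈-lookup j))
    lookup-injective (a ∷ _)  (suc i) zero    e = contradiction (sym e) (All.lookup a (∈-lookup i))
    lookup-injective (_ ∷ us) (suc i) (suc j) e = cong suc (lookup-injective us i j e)

    all-values values : List T
    all-values = cartesianProductWith f (allFin n) (allFin n)
    values = deduplicate _≟T_ all-values

    value∈ : ∀ α β → f α β List.∈ values
    value∈ α β = ∈-deduplicate⁺ _≟T_ (∈-cartesianProductWith⁺ f (∈-allFin α) (∈-allFin β))

    index-unique : ∀ {x} (m : x List.∈ values) i → List.lookup values i ≡ x → index m ≡ i
    index-unique m i e =
      lookup-injective (deduplicate-! _≟T_ all-values) _ _ (trans (sym (lookup-index m)) (sym e))

    values-attained : ∀ i → ∃₂ λ α β → index (value∈ α β) ≡ i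
    values-attained i =
      let α , β , _ , _ , e = ∈-cartesianProductWith⁻ f (allFin n) (allFin n)
                                (∈-deduplicate⁻ _≟T_ all-values (∈-lookup {xs = values} i))
      in α , β , index-unique (value∈ α β) i e

  fibres : Partition n
  fibres = record
    { rank     = List.length values
    ; colour   = λ α β → index (value∈ α β)
    ; nonempty = values-attained
    }

  fibres-⇔ : ∀ {α β γ δ} → Partition.colour fibres α β ≡ Partition.colour fibres γ δ ⇔ f α β ≡ f γ δ
  fibres-⇔ {α} {β} {γ} {δ} = mk⇔
    (index-injective (setoid T) (value∈ α β) (value∈ γ δ))
    (λ e → index-unique (value∈ α β) _ (trans (sym (lookup-index (value∈ γ δ))) (sym e)))

-- Equal fibre sizes give equal sizes for preimages of arbitrary sets.

bit : Bool → ℕ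
bit b = if b then 1 else 0

card-sum : ∀ {n} (q : Fin n → Bool) → ∣ tabulate q ∣ ≡ sum (bit ∘ q)
card-sum {zero}  q = refl
card-sum {suc n} q with q zero
... | true  = cong suc (card-sum (q ∘ suc))
... | false = card-sum (q ∘ suc)

sum-at : ∀ {m} (g : Fin m → ℕ) j → sum (λ k → g k * bit (does (j ≟ k))) ≡ g j
sum-at {suc m} g zero = begin
  g zero * 1 + sum (λ k → g (suc k) * 0)  ≡⟨ cong₂ _+_ (ℕ.*-identityʳ (g zero)) (sum-cong-≗ {m} (λ k → ℕ.*-zeroʳ (g (suc k)))) ⟩
  g zero + sum {m} (λ _ → 0)              ≡⟨ cong (g zero +_) (sum-zero m) ⟩
  g zero + 0                              ≡⟨ ℕ.+-identityʳ (g zero) ⟩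
  g zero                                  ∎
  where
  open ≡-Reasoning
  sum-zero : ∀ m → sum {m} (λ _ → 0) ≡ 0
  sum-zero zero    = refl
  sum-zero (suc m) = sum-zero m
sum-at {suc m} g (suc j) = trans
  (cong (_+ sum (λ k → g (suc k) * bit (does (j ≟ k)))) (ℕ.*-zeroʳ (g zero)))
  (sum-at (g ∘ suc) j)

card-preimage : ∀ {n m} (φ : Fin n → Fin m) (Q : Fin m → Bool) →
                ∣ tabulate (Q ∘ φ) ∣ ≡ sum (λ k → bit (Q k) * ∣ tabulate (λ ν → does (φ ν ≟ k)) ∣)
card-preimage {n} {m} φ Q = begin
  ∣ tabulate (Q ∘ φ) ∣                                           ≡⟨ card-sum (Q ∘ φ) ⟩
  sum (λ ν → bit (Q (φ ν)))                                      ≡⟨ sum-cong-≗ {n} (λ ν → sym (sum-at (bit ∘ Q) (φ ν))) ⟩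
  sum (λ ν → sum (λ k → bit (Q k) * bit (does (φ ν ≟ k))))       ≡⟨ ∑-comm {n} {m} _ ⟩
  sum (λ k → sum (λ ν → bit (Q k) * bit (does (φ ν ≟ k))))       ≡⟨ sum-cong-≗ {m} (λ k → sym (*-distribˡ-sum {n} (bit (Q k)) _)) ⟩
  sum (λ k → bit (Q k) * sum (λ ν → bit (does (φ ν ≟ k))))       ≡⟨ sum-cong-≗ {m} (λ k → cong (bit (Q k) *_) (sym (card-sum {n} _))) ⟩
  sum (λ k → bit (Q k) * ∣ tabulate (λ ν → does (φ ν ≟ k)) ∣)    ∎
  where open ≡-Reasoning

card-preimage-cong : ∀ {n m} (φ ψ : Fin n → Fin m) →
  (∀ k → ∣ tabulate (λ ν → does (φ ν ≟ k)) ∣ ≡ ∣ tabulate (λ ν → does (ψ ν ≟ k)) ∣) →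
  ∀ (Q : Fin m → Bool) → ∣ tabulate (Q ∘ φ) ∣ ≡ ∣ tabulate (Q ∘ ψ) ∣
card-preimage-cong {n} {m} φ ψ h Q =
  trans (card-preimage φ Q) (trans (sum-cong-≗ {m} (λ k → cong (bit (Q k) *_) (h k))) (sym (card-preimage ψ Q)))

subset-ext : ∀ {n} {p q : Subset n} → (∀ {x} → x ∈ p ⇔ x ∈ q) → p ≡ q
subset-ext h = ⊆-antisym (to h) (from h)

module _ {n : ℕ} (Y : CoherentConfiguration n) (P : Partition n)
         (Y⊑P : Refines (CoherentConfiguration.partition Y) P) where
  private
    module Y = CoherentConfiguration Y
    module P = Partition P

    pairColour : Fin n → Fin n → Fin n → Fin (Y.rank * Y.rank)
    pairColour α β ν = combine (Y.colour α ν) (Y.colour ν β)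

    coarse : Fin Y.rank → Fin P.rank
    coarse u = let α , β , _ = Y.nonempty u in P.colour α β

    coarse-colour : ∀ α β → coarse (Y.colour α β) ≡ P.colour α β
    coarse-colour α β = Y⊑P (proj₂ (proj₂ (Y.nonempty (Y.colour α β))))

    Q? : ∀ r s (k : Fin (Y.rank * Y.rank)) →
         Dec (coarse (proj₁ (remQuot Y.rank k)) ≡ r × coarse (proj₂ (remQuot {Y.rank} Y.rank k)) ≡ s)
    Q? r s k = (_ ≟ r) ×-dec (_ ≟ s)

    triangles-preimage : ∀ r s α β → P.triangles r s α β ≡ tabulate (λ ν → does (Q? r s (pairColour α β ν)))
    triangles-preimage r s α β = subset-ext λ {ν} → mk⇔
      (λ m → let p , q = to (∈-triangles P) m in
             from (∈-tabulate (Q? r s ∘ pairColour α β))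
                  (trans (fst ν) p , trans (snd ν) q))
      (λ m → let p , q = to (∈-tabulate (Q? r s ∘ pairColour α β)) m in
             from (∈-triangles P) (trans (sym (fst ν)) p , trans (sym (snd ν)) q))
      where
      fst : ∀ ν → coarse (proj₁ (remQuot Y.rank (pairColour α β ν))) ≡ P.colour α ν
      fst ν = trans (cong (coarse ∘ proj₁) (remQuot-combine (Y.colour α ν) (Y.colour ν β))) (coarse-colour α ν)
      snd : ∀ ν → coarse (proj₂ (remQuot {Y.rank} Y.rank (pairColour α β ν))) ≡ P.colour ν β
      snd ν = trans (cong (coarse ∘ proj₂) (remQuot-combine (Y.colour α ν) (Y.colour ν β))) (coarse-colour ν β)

    fibre-triangles : ∀ k α β → tabulate (λ ν → does (pairColour α β ν ≟ k)) ≡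
                      Y.triangles (proj₁ (remQuot Y.rank k)) (proj₂ (remQuot {Y.rank} Y.rank k)) α β
    fibre-triangles k α β = subset-ext λ {ν} → mk⇔
      (λ m → from (∈-triangles Y.partition) (fwd ν (to (∈-tabulate (λ ν → pairColour α β ν ≟ k)) m)))
      (λ m → from (∈-tabulate (λ ν → pairColour α β ν ≟ k)) (bwd ν (to (∈-triangles Y.partition) m)))
      where
      fwd : ∀ ν → pairColour α β ν ≡ k →
            Y.colour α ν ≡ proj₁ (remQuot Y.rank k) × Y.colour ν β ≡ proj₂ (remQuot {Y.rank} Y.rank k)
      fwd ν e = combine-injective _ _ _ _ (trans e (sym (combine-remQuot {Y.rank} Y.rank k)))
      bwd : ∀ ν → Y.colour α ν ≡ proj₁ (remQuot Y.rank k) × Y.colour ν β ≡ proj₂ (remQuot {Y.rank} Y.rank k) →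
            pairColour α β ν ≡ k
      bwd ν (p , q) = trans (cong₂ combine p q) (combine-remQuot {Y.rank} Y.rank k)

  coarse-triangles : ∀ {α β γ δ} → Y.colour α β ≡ Y.colour γ δ →
                     ∀ r s → ∣ P.triangles r s α β ∣ ≡ ∣ P.triangles r s γ δ ∣
  coarse-triangles {α} {β} {γ} {δ} e r s =
    trans (cong ∣_∣ (triangles-preimage r s α β))
      (trans (card-preimage-cong (pairColour α β) (pairColour γ δ) eq (does ∘ Q? r s))
        (sym (cong ∣_∣ (triangles-preimage r s γ δ))))
    where
    eq : ∀ k → ∣ tabulate (λ ν → does (pairColour α β ν ≟ k)) ∣ ≡ ∣ tabulate (λ ν → does (pairColour γ δ ν ≟ k)) ∣
    eq k = trans (cong ∣_∣ (fibre-triangles k α β))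
      (trans (Y.coherent _ _ (Y.colour α β) α β γ δ
               (from (∈-basis Y.partition) refl) (from (∈-basis Y.partition) (sym e)))
        (sym (cong ∣_∣ (fibre-triangles k γ δ))))

module _ {n : ℕ} (P : Partition n) where
  open Partition P

  Signature : Set
  Signature = Fin rank × Fin rank × Vec (Vec ℕ rank) rank

  signature : Fin n → Fin n → Signature
  signature α β = colour α β , colour β α , tabulate λ r → tabulate λ s → ∣ triangles r s α β ∣

  signature-≟ : DecidableEquality Signature
  signature-≟ = Product.≡-dec _≟_ (Product.≡-dec _≟_ (Vec.≡-dec (Vec.≡-dec ℕ._≟_)))

  refine : Partition n
  refine = Fibres.fibres signature-≟ signature

  Stable : Set
  Stable = ∀ {α β γ δ} → colour α β ≡ colour γ δ → signature α β ≡ signature γ δ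

  refine-refines : Refines refine P
  refine-refines e = cong proj₁ (to (Fibres.fibres-⇔ signature-≟ signature) e)

  private
    fourth : Fin ((n * n) * (n * n)) → (Fin n × Fin n) × (Fin n × Fin n)
    fourth i = let p , q = remQuot {n * n} (n * n) i in remQuot {n} n p , remQuot {n} n q

    SameColour : Fin ((n * n) * (n * n)) → Set
    SameColour i = let (α , β) , (γ , δ) = fourth i in colour α β ≡ colour γ δ

    sameColour? : Decidable SameColour
    sameColour? i = _ ≟ _

  kernel : Subset ((n * n) * (n * n))
  kernel = tabulate (does ∘ sameColour?)

  ∈-kernel : ∀ {i} → i ∈ kernel ⇔ SameColour i
  ∈-kernel = ∈-tabulate sameColour?

  ∈-kernel-combine : ∀ {α β γ δ} → combine (combine α β) (combine γ δ) ∈ kernel ⇔ colour α β ≡ colour γ δ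
  ∈-kernel-combine {α} {β} {γ} {δ} = mk⇔
    (λ m → subst Same eq (to ∈-kernel m)) (λ e → from ∈-kernel (subst Same (sym eq) e))
    where
    Same : (Fin n × Fin n) × (Fin n × Fin n) → Set
    Same ((α , β) , (γ , δ)) = colour α β ≡ colour γ δ
    eq : fourth (combine (combine α β) (combine γ δ)) ≡ ((α , β) , (γ , δ))
    eq = trans
      (cong (λ (p , q) → remQuot {n} n p , remQuot {n} n q) (remQuot-combine (combine α β) (combine γ δ)))
      (cong₂ _,_ (remQuot-combine α β) (remQuot-combine γ δ))

shrinks? : ∀ {n} (P : Partition n) → Dec (kernel (refine P) ⊂ kernel P)
shrinks? P = map′ (λ h → sub , h) proj₂ (any? λ i → (i ∈? kernel P) ×-dec ¬? (i ∈? kernel (refine P)))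
  where
  sub : kernel (refine P) ⊆ kernel P
  sub m = from (∈-kernel P) (refine-refines P (to (∈-kernel (refine P)) m))

¬shrinks⇒stable : ∀ {n} (P : Partition n) → ¬ (kernel (refine P) ⊂ kernel P) → Stable P
¬shrinks⇒stable P h {α} {β} {γ} {δ} e =
  to (Fibres.fibres-⇔ (signature-≟ P) (signature P))
    (to (∈-kernel-combine (refine P)) (decidable-stable (i ∈? kernel (refine P)) λ i∉ →
      h ( (λ m → from (∈-kernel P) (refine-refines P (to (∈-kernel (refine P)) m)))
        , i , from (∈-kernel-combine P) e , i∉)))
  where i = combine (combine α β) (combine γ δ)

refine-greatest : ∀ {n} (Y : CoherentConfiguration n) (P : Partition n) →
                  Refines (CoherentConfiguration.partition Y) P →
                  Refines (CoherentConfiguration.partition Y) (refine P)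
refine-greatest Y P Y⊑P {α} {β} {γ} {δ} e =
  from (Fibres.fibres-⇔ (signature-≟ P) (signature P))
    (cong₂ _,_ (Y⊑P e) (cong₂ _,_ (Y⊑P (colour-converse e))
      (Vec.tabulate-cong λ r → Vec.tabulate-cong λ s → coarse-triangles Y P Y⊑P e r s)))
  where
  module Y = CoherentConfiguration Y
  flip : ∀ {s α β} → Y.colour α β ≡ s → Y.colour β α ≡ s Y.*ᵇ
  flip {s} {α} {β} e = to (∈-basis Y.partition) (subst (α ∈_) (sym (proj₂ (Y.converse-basis s) β))
    (from (∈-converse (Y.basis s)) (from (∈-basis Y.partition) e)))
  colour-converse : Y.colour α β ≡ Y.colour γ δ → Y.colour β α ≡ Y.colour δ γ
  colour-converse e = trans (flip e) (sym (flip refl))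

record StableRefinement {n} (P : Partition n) : Set where
  field
    result   : Partition n
    refines  : Refines result P
    stable   : Stable result
    coarsest : ∀ (Y : CoherentConfiguration n) → Refines (CoherentConfiguration.partition Y) P →
               Refines (CoherentConfiguration.partition Y) result

stableRefinement : ∀ {n} (P : Partition n) → StableRefinement P
stableRefinement P = go P (⊂-wellFounded (kernel P))
  where
  go : ∀ P → Acc _⊂_ (kernel P) → StableRefinement P
  go P (acc rs) with shrinks? P
  ... | no ¬shrinks = record
    { result = P ; refines = λ e → e ; stable = ¬shrinks⇒stable P ¬shrinks ; coarsest = λ Y h → h }
  ... | yes shrinks = record
    { result   = R.result
    ; refines  = λ e → refine-refines P (R.refines e)
    ; stable   = R.stable
    ; coarsest = λ Y h → R.coarsest Y (refine-greatest Y P h)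
    }
    where module R = StableRefinement (go (refine P) (rs shrinks))

stable⇒coherent : ∀ {n} (P : Partition n) → Stable P → Partition.IsRelation P diagonal → CoherentConfiguration n
stable⇒coherent P stable diag = record
  { partition         = P
  ; diagonal-relation = diag
  ; converse-basis    = λ s → let α , β , e = nonempty s in colour β α , λ γ → subset-ext λ {δ} → mk⇔
      (λ m → from (∈-converse (basis s)) (from (∈-basis P) (trans (flip (to (∈-basis P) m)) e)))
      (λ m → from (∈-basis P) (flip (trans (to (∈-basis P) (to (∈-converse (basis s)) m)) (sym e))))
  ; coherent          = λ r s t α β γ δ m m′ →
      entry (cong (proj₂ ∘ proj₂) (stable (trans (to (∈-basis P) m) (sym (to (∈-basis P) m′))))) r s
  }
  where
  open Partition P
  flip : ∀ {α β γ δ} → colour α β ≡ colour γ δ → colour β α ≡ colour δ γ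
  flip e = cong (proj₁ ∘ proj₂) (stable e)
  entry : ∀ {m} {f g : Fin m → Fin m → ℕ} →
          tabulate (λ r → tabulate (f r)) ≡ tabulate (λ r → tabulate (g r)) → ∀ r s → f r s ≡ g r s
  entry e r s = at (at e r) s
    where
    at : ∀ {m} {A : Set} {f g : Fin m → A} → tabulate f ≡ tabulate g → ∀ i → f i ≡ g i
    at {f = f} {g} e i =
      trans (sym (Vec.lookup∘tabulate f i)) (trans (cong (λ v → lookup v i) e) (Vec.lookup∘tabulate g i))

module _ {n : ℕ} (X : CoherentConfiguration n) (A : Subset n) where
  private
    module X = CoherentConfiguration X

    Label : Set
    Label = Fin X.rank × Maybe (Fin n)

    mark : Fin n → Fin n → Maybe (Fin n)
    mark α β = if does ((α ≟ β) ×-dec (α ∈? A)) then just α else nothing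

    label : Fin n → Fin n → Label
    label α β = X.colour α β , mark α β

    label-≟ : DecidableEquality Label
    label-≟ = Product.≡-dec _≟_ (Maybe.≡-dec _≟_)

    initial : Partition n
    initial = Fibres.fibres label-≟ label

    module R = StableRefinement (stableRefinement initial)

    result-label : ∀ {α β γ δ} → Partition.colour R.result α β ≡ Partition.colour R.result γ δ →
                   label α β ≡ label γ δ
    result-label e = to (Fibres.fibres-⇔ label-≟ label) (R.refines e)

    mark-just : ∀ {α} → α ∈ A → mark α α ≡ just α
    mark-just {α} m rewrite dec-true ((α ≟ α) ×-dec (α ∈? A)) (refl , m) = refl

    just-mark : ∀ {α β γ} → mark α β ≡ just γ → (α ≡ γ × β ≡ γ) × γ ∈ A
    just-mark {α} {β} e with α ≟ β | α ∈? A
    just-mark refl | yes refl | yes m = (refl , refl) , m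
    just-mark ()   | yes _    | no _
    just-mark ()   | no _     | _

    move : ∀ Z → Fixes Z A → ∀ {α β γ δ ε} → mark α β ≡ just ε →
           CoherentConfiguration.colour Z α β ≡ CoherentConfiguration.colour Z γ δ → mark γ δ ≡ just ε
    move Z fixed {ε = ε} p e =
      let α≡β≡ε , m = just-mark p
          γ≡ε , δ≡ε = to ∈-singleton (relation⇒closed (CoherentConfiguration.partition Z) (fixed ε m) e
                                       (from ∈-singleton α≡β≡ε))
      in trans (cong₂ mark γ≡ε δ≡ε) (mark-just m)

    mark-cong : ∀ Z → Fixes Z A → ∀ {α β γ δ} →
                CoherentConfiguration.colour Z α β ≡ CoherentConfiguration.colour Z γ δ → mark α β ≡ mark γ δ
    mark-cong Z fixed {α} {β} {γ} {δ} e with mark α β in p | mark γ δ in q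
    ... | nothing | nothing = refl
    ... | just ε  | _       = sym (trans (sym q) (move Z fixed p e))
    ... | nothing | just ε  = trans (sym p) (move Z fixed q (sym e))

  -- Opaque to keep type checking fast; pointExtension-isPointExtension
  -- determines it up to the numbering of the basis relations.

  opaque
    pointExtension : CoherentConfiguration n
    pointExtension = stable⇒coherent R.result R.stable
      (closed⇒relation R.result λ e →
        relation⇒closed X.partition X.diagonal-relation (cong proj₁ (result-label e)))

    pointExtension-isPointExtension : IsPointExtension X A pointExtension
    pointExtension-isPointExtension = record
      { extends  = refines⇒≼ X pointExtension (λ e → cong proj₁ (result-label e))
      ; fixes    = λ α α∈A → closed⇒relation R.result λ e m →
          let p , q = to ∈-singleton m in
          from ∈-singleton (proj₁ (just-mark
            (trans (sym (cong proj₂ (result-label e))) (trans (cong₂ mark p q) (mark-just α∈A)))))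
      ; smallest = λ Z X≼Z fixed → refines⇒≼ pointExtension Z
          (R.coarsest Z λ e → from (Fibres.fibres-⇔ label-≟ label)
            (cong₂ _,_ (≼⇒refines X Z X≼Z e) (mark-cong Z fixed e)))
      }

IsBase : ∀ {n} → CoherentConfiguration n → Subset n → Set
IsBase X A = IsComplete (pointExtension X A)

record IsBaseNumber {n} (X : CoherentConfiguration n) (b : ℕ) : Set where
  field
    attained : ∃ λ A → IsBase X A × ∣ A ∣ ≡ b
    minimal  : ∀ A → IsBase X A → b ≤ ∣ A ∣

isBase? : ∀ {n} (X : CoherentConfiguration n) → Decidable (IsBase X)
isBase? X A = all? λ r → any? λ α → any? λ β → all? λ γ →
  Vec.≡-dec Bool._≟_ (Y.basis r γ) (singleton α β γ)
  where module Y = CoherentConfiguration (pointExtension X A)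

-- A pair (α , β) is recovered from its colour through the triangles α α β and
-- α β β.

fixes-⊤⇒complete : ∀ {n} (Y : CoherentConfiguration n) → Fixes Y ⊤ → IsComplete Y
fixes-⊤⇒complete Y fixes-⊤ r =
  let α , β , e = Y.nonempty r in
  α , β , λ γ → subset-ext λ {δ} → mk⇔
    (λ m → from ∈-singleton (determined (trans (to (∈-basis Y.partition) m) (sym e))))
    (λ m → let p , q = to ∈-singleton m in
           from (∈-basis Y.partition) (trans (cong₂ Y.colour p q) e))
  where
  module Y = CoherentConfiguration Y

  fixed : ∀ {α γ δ} → Y.colour γ δ ≡ Y.colour α α → γ ≡ α × δ ≡ α
  fixed {α} e = to ∈-singleton (relation⇒closed Y.partition
    (fixes-⊤ α ∈⊤) (sym e) (from (∈-singleton {α = α}) (refl , refl)))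

  inhabited : ∀ {n} {p q : Subset n} {x} → ∣ p ∣ ≡ ∣ q ∣ → x ∈ p → ∃ (_∈ q)
  inhabited {n} {p} {q} {x} e x∈p with nonempty? q
  ... | yes h = h
  ... | no  h = contradiction
    (subst (∣ p Subset.- x ∣ <_) (trans e (trans (cong ∣_∣ (Empty-unique h)) (∣⊥∣≡0 n))) (x∈p⇒∣p-x∣<∣p∣ x∈p)) λ ()

  determined : ∀ {α β γ δ} → Y.colour γ δ ≡ Y.colour α β → γ ≡ α × δ ≡ β
  determined {α} {β} {γ} {δ} e = proj₁ (fixed (proj₁ (to (∈-triangles Y.partition) (proj₂ left)))) ,
                                 proj₂ (fixed (proj₂ (to (∈-triangles Y.partition) (proj₂ right))))
    where
    same : ∀ r s → ∣ Y.triangles r s α β ∣ ≡ ∣ Y.triangles r s γ δ ∣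
    same r s = Y.coherent r s (Y.colour α β) α β γ δ (from (∈-basis Y.partition) refl) (from (∈-basis Y.partition) e)
    left = inhabited (same (Y.colour α α) (Y.colour α β)) (from (∈-triangles Y.partition) (refl , refl))
    right = inhabited (same (Y.colour α β) (Y.colour β β)) (from (∈-triangles Y.partition) (refl , refl))

⊤-isBase : ∀ {n} (X : CoherentConfiguration n) → IsBase X ⊤
⊤-isBase X = fixes-⊤⇒complete (pointExtension X ⊤)
  (IsPointExtension.fixes (pointExtension-isPointExtension X ⊤))

least : ∀ {P : ℕ → Set} → Decidable P → ∀ m → P m → ∃ λ b → P b × (∀ j → P j → b ≤ j)
least {P} P? m = go m (<-wellFounded m)
  where
  go : ∀ m → Acc _<_ m → P m → ∃ λ b → P b × (∀ j → P j → b ≤ j)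
  go m (acc rs) p with ℕ.anyUpTo? P? m
  ... | yes (k , k<m , q) = go k (rs k<m) q
  ... | no  none          = m , p , λ j q → ℕ.≮⇒≥ λ j<m → none (j , j<m , q)

leastBase : ∀ {n} (X : CoherentConfiguration n) → ∃ (IsBaseNumber X)
leastBase {n} X =
  let b , attained , minimal = least (λ b → anySubset? λ A → isBase? X A ×-dec (∣ A ∣ ℕ.≟ b))
                                     ∣ ⊤ {n} ∣ (⊤ , ⊤-isBase X , refl)
  in b , record { attained = attained ; minimal = λ A base → minimal ∣ A ∣ (A , base , refl) }

baseNumber : ∀ {n} → CoherentConfiguration n → ℕ
baseNumber X = proj₁ (leastBase X)

baseNumber-isBaseNumber : ∀ {n} (X : CoherentConfiguration n) → IsBaseNumber X (baseNumber X)
baseNumber-isBaseNumber X = proj₂ (leastBase X)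

{-# OPTIONS --safe #-}

-- Fix α, let r(β,γ) be the basis relation of X containing (β,γ), and write
-- β ⇒ γ when γ is the only δ with (β,δ) in the basis relation of X_α containing
-- (β,γ). The relation ⇒ is transitive. For γ ∈ αs, if no other γ′ ∈ αs has
-- r(β,γ′) = r(β,γ), then β ⇒ γ. Each γ′ rules out at most c points β, so all
-- but at most c(k − 1) < n/2 points β satisfy β ⇒ γ. Hence any two points have
-- a common ⇒-predecessor, and by transitivity and finiteness so do all points
-- together: this predecessor β is a regular point of X_α, and then {α,β} is a
-- base.

module Submission where

open import Defs
open import Data.Fin.Base using (Fin; zero; suc)
open import Data.Fin.Properties using (_≟_; any?)
open import Data.Fin.Subset
  using (Subset; inside; outside; _∈_; _⊆_; _∪_; _-_; ⁅_⁆; ∣_∣; ⋃) renaming (⊥ to ∅; ⊤ to full)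
open import Data.Fin.Subset.Properties
open import Data.List.Base as List using (List; []; _∷_; allFin)
import Data.List.Extrema.Nat as Extrema
import Data.List.Membership.Propositional as List
open import Data.List.Membership.Propositional.Properties using (∈-allFin; ∈-filter⁺; ∈-map⁺)
import Data.List.Properties as List
import Data.List.Relation.Unary.All as All
open import Data.List.Relation.Unary.Any using (here; there)
open import Data.Nat.Base using (ℕ; zero; suc; _+_; _*_; _∸_; _≤_; _<_; z≤n; s≤s)
open import Data.Nat.ListAction using (sum)
open import Data.Nat.Properties hiding (_≟_)
open import Data.Nat.Tactic.RingSolver using (solve-∀)
open import Data.Product.Base using (∃; _×_; _,_; proj₁; proj₂)
open import Data.Sum.Base using (inj₁; inj₂)
open import Data.Vec.Base using (tabulate; []; _∷_; here; there)
open import Function.Base using (_∘_; id)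
open import Function.Bundles using (Equivalence)
open import Relation.Binary.Core using (Rel)
open import Relation.Binary.Definitions using (Transitive)
open import Relation.Binary.PropositionalEquality
  using (_≡_; _≢_; refl; sym; trans; cong; cong₂; subst)
open import Relation.Nullary using (yes; no; does; ¬_; ¬?; contradiction)

open Equivalence using (to; from)

-- Counting in finite subsets and lists.

∣p∪q∣≤∣p∣+∣q∣ : ∀ {n} (p q : Subset n) → ∣ p ∪ q ∣ ≤ ∣ p ∣ + ∣ q ∣
∣p∪q∣≤∣p∣+∣q∣ []            []            = z≤n
∣p∪q∣≤∣p∣+∣q∣ (outside ∷ p) (outside ∷ q) = ∣p∪q∣≤∣p∣+∣q∣ p q
∣p∪q∣≤∣p∣+∣q∣ (outside ∷ p) (inside  ∷ q) =
  ≤-trans (s≤s (∣p∪q∣≤∣p∣+∣q∣ p q)) (≤-reflexive (sym (+-suc ∣ p ∣ ∣ q ∣)))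
∣p∪q∣≤∣p∣+∣q∣ (inside  ∷ p) (outside ∷ q) = s≤s (∣p∪q∣≤∣p∣+∣q∣ p q)
∣p∪q∣≤∣p∣+∣q∣ (inside  ∷ p) (inside  ∷ q) =
  s≤s (≤-trans (∣p∪q∣≤∣p∣+∣q∣ p q) (+-monoʳ-≤ ∣ p ∣ (n≤1+n ∣ q ∣)))

∣⋃∣≤sum : ∀ {n} (ps : List (Subset n)) → ∣ ⋃ ps ∣ ≤ sum (List.map ∣_∣ ps)
∣⋃∣≤sum {n} []   = ≤-reflexive (∣⊥∣≡0 n)
∣⋃∣≤sum (p ∷ ps) = ≤-trans (∣p∪q∣≤∣p∣+∣q∣ p (⋃ ps)) (+-monoʳ-≤ ∣ p ∣ (∣⋃∣≤sum ps))

∈-⋃⁺ : ∀ {n x} {p : Subset n} {ps} → p List.∈ ps → x ∈ p → x ∈ ⋃ ps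
∈-⋃⁺ (here refl) x∈p = x∈p∪q⁺ (inj₁ x∈p)
∈-⋃⁺ (there p∈)  x∈p = x∈p∪q⁺ (inj₂ (∈-⋃⁺ p∈ x∈p))

-- A union bound over an index set. The size of `f i` is bounded only for `i ∈ I` because the
-- application, `ties δ γ`, is the whole point set at `δ = γ`.
family-cover : ∀ {m n} (I : Subset m) (f : Fin m → Subset n) c → (∀ {i} → i ∈ I → ∣ f i ∣ ≤ c) →
               ∃ λ U → ∣ U ∣ ≤ ∣ I ∣ * c × (∀ {i} → i ∈ I → f i ⊆ U)
family-cover {n = n} [] f c h = ∅ , ≤-reflexive (∣⊥∣≡0 n) , λ ()
family-cover (outside ∷ I) f c h =
  let U , ∣U∣≤ , covers = family-cover I (f ∘ suc) c (h ∘ there)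
  in U , ∣U∣≤ , λ { (there i∈I) → covers i∈I }
family-cover (inside ∷ I) f c h =
  let U , ∣U∣≤ , covers = family-cover I (f ∘ suc) c (h ∘ there)
  in f zero ∪ U ,
     ≤-trans (∣p∪q∣≤∣p∣+∣q∣ (f zero) U) (+-mono-≤ (h here) ∣U∣≤) ,
     λ { here m → x∈p∪q⁺ (inj₁ m) ; (there i∈I) m → x∈p∪q⁺ (inj₂ (covers i∈I m)) }

-- Removing `x` a second time changes nothing, yet would lower the cardinality if `x` were still
-- present.
x∉p-x : ∀ {n} (p : Subset n) {x} → ¬ x ∈ p - x
x∉p-x p {x} x∈p-x = <-irrefl (cong ∣_∣ (p─q─q≡p─q p ⁅ x ⁆)) (x∈p⇒∣p-x∣<∣p∣ x∈p-x)

∣p∣<n⇒∃∉ : ∀ {n} (p : Subset n) → ∣ p ∣ < n → ∃ λ x → ¬ x ∈ p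
∣p∣<n⇒∃∉ {n} p ∣p∣<n with any? (λ x → ¬? (x ∈? p))
... | yes h = h
... | no  h = contradiction ∣p∣<n (≤⇒≯ (subst (_≤ ∣ p ∣) (∣⊤∣≡n n) (p⊆q⇒∣p∣≤∣q∣ all∈p)))
  where
  all∈p : full ⊆ p
  all∈p {x} _ with x ∈? p
  ... | yes x∈p = x∈p
  ... | no  x∉p = contradiction (x , x∉p) h

nonempty-cong : ∀ {n} {p q : Subset n} {x} → ∣ p ∣ ≡ ∣ q ∣ → x ∈ p → ∃ (_∈ q)
nonempty-cong {n} {p} {q} {x} e x∈p with nonempty? q
... | yes h = h
... | no  h = contradiction
  (subst (∣ p - x ∣ <_) (trans e (trans (cong ∣_∣ (Empty-unique h)) (∣⊥∣≡0 n))) (x∈p⇒∣p-x∣<∣p∣ x∈p)) λ ()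

at-most-one⇒∣p∣≤1 : ∀ {n} (p : Subset n) → (∀ {x y} → x ∈ p → y ∈ p → x ≡ y) → ∣ p ∣ ≤ 1
at-most-one⇒∣p∣≤1 {n} p h with nonempty? p
... | yes (x , x∈p) = subst (∣ p ∣ ≤_) (∣⁅x⁆∣≡1 x)
  (p⊆q⇒∣p∣≤∣q∣ λ y∈p → subst (_∈ ⁅ x ⁆) (h x∈p y∈p) (x∈⁅x⁆ x))
... | no  empty = subst (_≤ 1) (sym (trans (cong ∣_∣ (Empty-unique empty)) (∣⊥∣≡0 n))) z≤n

≤-max-map : ∀ {A : Set} (f : A → ℕ) {x} {xs : List A} → x List.∈ xs → f x ≤ Extrema.max 0 (List.map f xs)
≤-max-map f {xs = xs} x∈xs = All.lookup (Extrema.xs≤max 0 (List.map f xs)) (∈-map⁺ f x∈xs)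

-- Bounds are merged one value at a time. The family `f` lets the induction run on `m` while the
-- points stay in `Fin n`; `x₀` serves the empty family.
common-lower-bound : ∀ {n ℓ} {_⇒_ : Rel (Fin n) ℓ} → Transitive _⇒_ →
                     (∀ x y → ∃ λ z → z ⇒ x × z ⇒ y) →
                     Fin n → ∀ {m} (f : Fin m → Fin n) → ∃ λ z → ∀ i → z ⇒ f i
common-lower-bound ⇒-trans lower x₀ {zero}  f = x₀ , λ ()
common-lower-bound ⇒-trans lower x₀ {suc m} f =
  let z , z⇒ = common-lower-bound ⇒-trans lower x₀ (f ∘ suc)
      w , w⇒z , w⇒f₀ = lower z (f zero)
  in w , λ { zero → w⇒f₀ ; (suc i) → ⇒-trans w⇒z (z⇒ i) }

-- The relation `⇒` and fixed points in a coherent configuration.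

module _ {n : ℕ} (Y : CoherentConfiguration n) where
  private module Y = CoherentConfiguration Y

  -- Coherence without counting: an intersection number that is positive at one pair is positive at
  -- every pair of the same colour.
  triangle-transport : ∀ {α β γ δ} → Y.colour α β ≡ Y.colour γ δ → ∀ ν →
                       ∃ λ ν′ → Y.colour γ ν′ ≡ Y.colour α ν × Y.colour ν′ δ ≡ Y.colour ν β
  triangle-transport {α} {β} {γ} {δ} e ν =
    let ν′ , m = nonempty-cong
          (Y.coherent _ _ (Y.colour γ δ) α β γ δ (from (∈-basis Y.partition) e) (from (∈-basis Y.partition) refl))
          (from (∈-triangles Y.partition) (refl , refl))
    in ν′ , to (∈-triangles Y.partition) m

  diagonal-colour : ∀ {α β γ} → Y.colour α α ≡ Y.colour β γ → β ≡ γ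
  diagonal-colour {α} {β} e =
    sym (x∈⁅y⁆⇒x≡y β (relation⇒closed Y.partition Y.diagonal-relation e (x∈⁅x⁆ α)))

  colour-converse : ∀ α β → Y.colour β α ≡ Y.colour α β Y.*ᵇ
  colour-converse α β = to (∈-basis Y.partition)
    (subst (α ∈_) (sym (proj₂ (Y.converse-basis (Y.colour α β)) β))
      (from (∈-converse (Y.basis (Y.colour α β))) (from (∈-basis Y.partition) refl)))

  infix 4 _⇒_

  _⇒_ : Fin n → Fin n → Set
  β ⇒ γ = ∀ {δ} → Y.colour β δ ≡ Y.colour β γ → δ ≡ γ

  -- Transport the triangle with apex `γ` to the competing pair: `β ⇒ γ` forces the new apex to be
  -- `γ` again, and `γ ⇒ δ` then forces the endpoint.
  ⇒-trans : Transitive _⇒_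
  ⇒-trans {β} {γ} {δ} β⇒γ γ⇒δ e with triangle-transport (sym e) γ
  ... | ν , p , q with refl ← β⇒γ p = γ⇒δ q

  ⇒-all⇒regular : ∀ {β} → (∀ γ → β ⇒ γ) → IsRegularPoint Y β
  ⇒-all⇒regular {β} β⇒ r = at-most-one⇒∣p∣≤1 (Y.basis r β) λ x∈ y∈ →
    β⇒ _ (trans (to (∈-basis Y.partition) x∈) (sym (to (∈-basis Y.partition) y∈)))

  module _ {A : Subset n} (fixed : Fixes Y A) where

    fixed-loop : ∀ {α} → α ∈ A → ∀ {β γ} → Y.colour β γ ≡ Y.colour α α → β ≡ α
    fixed-loop {α} α∈A e = proj₁ (to ∈-singleton (relation⇒closed Y.partition
      (fixed α α∈A) (sym e) (from (∈-singleton {α = α}) (refl , refl))))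

    -- Transporting the degenerate triangle with apex `α` yields an arrow out of `β` with the colour
    -- of the loop at `α`.
    fixed-source : ∀ {α} → α ∈ A → ∀ {β γ δ} → Y.colour β δ ≡ Y.colour α γ → β ≡ α
    fixed-source {α} α∈A e = let _ , p , _ = triangle-transport (sym e) α in fixed-loop α∈A p

    -- Transport the triangle with apex `α`: its new apex emits an arrow coloured like one out of
    -- `α`, so it is `α` itself.
    fixed-colour : ∀ {α} → α ∈ A → ∀ {β γ δ ε} → Y.colour β γ ≡ Y.colour δ ε →
                   Y.colour α γ ≡ Y.colour α ε
    fixed-colour {α} α∈A e with triangle-transport (sym e) α
    ... | _ , _ , q with refl ← fixed-source α∈A q = q

    -- It suffices that every point is fixed. A pair coloured like a loop is a loop, and `β` sees
    -- the two looped points in the same colour, so they coincide.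
    ⇒-all⇒complete : ∀ {β} → β ∈ A → (∀ γ → β ⇒ γ) → IsComplete Y
    ⇒-all⇒complete β∈A β⇒ = fixes-⊤⇒complete Y λ γ _ →
      closed⇒relation Y.partition λ e m → from ∈-singleton (fixed-pair e (to ∈-singleton m))
      where
      fixed-pair : ∀ {α β γ δ ε} → Y.colour α β ≡ Y.colour γ δ → α ≡ ε × β ≡ ε → γ ≡ ε × δ ≡ ε
      fixed-pair e (refl , refl) with refl ← diagonal-colour e =
        let eq = β⇒ _ (sym (fixed-colour β∈A e)) in eq , eq

-- Bounding the points that fail to distinguish.

module _ {n : ℕ} (X : CoherentConfiguration n) where
  private module X = CoherentConfiguration X

  ties : Fin n → Fin n → Subset n
  ties γ δ = tabulate λ β → does (X.colour β γ ≟ X.colour β δ)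

  -- A tied point `β` is the apex of a triangle of type `s`, `s *ᵇ` over `(γ , δ)`, where `s` is the
  -- colour of `(γ , β)`; the sum over `s` bounds the union.
  ∣ties∣≤relationIndistinguishingNumber : ∀ γ δ →
    ∣ ties γ δ ∣ ≤ relationIndistinguishingNumber X (X.colour γ δ)
  ∣ties∣≤relationIndistinguishingNumber γ δ = begin
    ∣ ties γ δ ∣                                   ≤⟨ p⊆q⇒∣p∣≤∣q∣ ties⊆⋃ ⟩
    ∣ ⋃ (List.map isosceles (allFin X.rank)) ∣     ≤⟨ ∣⋃∣≤sum (List.map isosceles (allFin X.rank)) ⟩
    sum (List.map ∣_∣ (List.map isosceles (allFin X.rank)))
      ≡⟨ cong sum (List.map-∘ (allFin X.rank)) ⟨
    sum (List.map (∣_∣ ∘ isosceles) (allFin X.rank))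
      ≡⟨ cong sum (List.map-cong ∣isosceles∣ (allFin X.rank)) ⟩
    relationIndistinguishingNumber X (X.colour γ δ) ∎
    where
    open ≤-Reasoning
    isosceles : Fin X.rank → Subset n
    isosceles s = X.triangles s (s X.*ᵇ) γ δ
    ∣isosceles∣ : ∀ s → ∣ isosceles s ∣ ≡ X.intersectionNumber s (s X.*ᵇ) (X.colour γ δ)
    ∣isosceles∣ s = let _ , _ , e = X.nonempty (X.colour γ δ) in
      X.coherent s (s X.*ᵇ) (X.colour γ δ) _ _ _ _ (from (∈-basis X.partition) refl) (from (∈-basis X.partition) e)
    ties⊆⋃ : ties γ δ ⊆ ⋃ (List.map isosceles (allFin X.rank))
    ties⊆⋃ {β} m = ∈-⋃⁺ (∈-map⁺ isosceles (∈-allFin (X.colour γ β))) (from (∈-triangles X.partition)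
      (refl , trans (sym (to (∈-tabulate (λ β → X.colour β γ ≟ X.colour β δ)) m)) (colour-converse X γ β)))

  module _ (hom : IsHomogeneous X) where

    -- The maximum runs over the non-diagonal colours, and `γ ≢ δ` places the colour of `(γ , δ)`
    -- among them.
    ∣ties∣≤indistinguishingNumber : ∀ {γ δ} → γ ≢ δ → ∣ ties γ δ ∣ ≤ indistinguishingNumber X hom
    ∣ties∣≤indistinguishingNumber {γ} {δ} γ≢δ = ≤-trans (∣ties∣≤relationIndistinguishingNumber γ δ)
      (≤-max-map (relationIndistinguishingNumber X)
        (∈-filter⁺ (λ r → ¬? (r ≟ proj₁ hom)) (∈-allFin (X.colour γ δ)) λ e →
          γ≢δ (sym (x∈⁅y⁆⇒x≡y γ (subst (δ ∈_) (proj₂ hom γ) (from (∈-basis X.partition) e))))))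

    ∣basis∣≤maxValency : ∀ s α → ∣ X.basis s α ∣ ≤ maxValency X
    ∣basis∣≤maxValency s α = subst (_≤ maxValency X) (sym (valency-unique X hom s α))
      (≤-max-map (valency X) (∈-allFin s))

    ambiguous-points : ∀ α γ → ∃ λ U → ∣ U ∣ ≤ (maxValency X ∸ 1) * indistinguishingNumber X hom ×
      (∀ {β δ} → X.colour α δ ≡ X.colour α γ → δ ≢ γ → X.colour β δ ≡ X.colour β γ → β ∈ U)
    ambiguous-points α γ =
      let U , ∣U∣≤ , covers = family-cover others (λ δ → ties δ γ) (indistinguishingNumber X hom)
                                (λ m → ∣ties∣≤indistinguishingNumber (≢γ m))
      in U , ≤-trans ∣U∣≤ (*-monoˡ-≤ (indistinguishingNumber X hom) ∣others∣≤) ,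
         λ {β} {δ} e δ≢γ tie → covers (x∈p∧x≢y⇒x∈p-y (from (∈-basis X.partition) e) δ≢γ)
           (from (∈-tabulate (λ β → X.colour β δ ≟ X.colour β γ)) tie)
      where
      others : Subset n
      others = X.basis (X.colour α γ) α - γ
      ≢γ : ∀ {δ} → δ ∈ others → δ ≢ γ
      ≢γ m refl = x∉p-x (X.basis (X.colour α γ) α) m
      ∣others∣≤ : ∣ others ∣ ≤ maxValency X ∸ 1
      -- The point `γ` itself is among those removed, so the count is strictly below the valency.
      ∣others∣≤ = ∸-monoˡ-≤ 1 (≤-trans (x∈p⇒∣p-x∣<∣p∣ (from (∈-basis X.partition) refl))
        (∣basis∣≤maxValency (X.colour α γ) α))

    -- Regular points of one point extensions and two-point bases.

    module _ (small : 2 * indistinguishingNumber X hom * (maxValency X ∸ 1) < n) where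

      regular-point : ∀ α → ∃ λ β → ∀ γ → _⇒_ (pointExtension X ⁅ α ⁆) β γ
      regular-point α = common-lower-bound (λ {β} {γ} {δ} → ⇒-trans Y {β} {γ} {δ}) common α id
        where
        Y = pointExtension X ⁅ α ⁆
        open IsPointExtension (pointExtension-isPointExtension X ⁅ α ⁆)
        c = indistinguishingNumber X hom
        k = maxValency X

        -- Equal colours from `β` in the extension give equal colours in `X` both from `β` and,
        -- since `α` is fixed, from `α`. A second such point would make `β` ambiguous.
        unambiguous⇒ : ∀ {β γ} → ¬ β ∈ proj₁ (ambiguous-points α γ) → _⇒_ Y β γ
        unambiguous⇒ {β} {γ} β∉ {δ} e with δ ≟ γ
        ... | yes δ≡γ = δ≡γ
        ... | no  δ≢γ = contradiction
          (proj₂ (proj₂ (ambiguous-points α γ))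
            (≼⇒refines X Y extends (fixed-colour Y fixes (x∈⁅x⁆ α) e)) δ≢γ
            (≼⇒refines X Y extends e))
          β∉

        common : ∀ γ δ → ∃ λ β → _⇒_ Y β γ × _⇒_ Y β δ
        common γ δ =
          let U , ∣U∣≤ , _ = ambiguous-points α γ
              V , ∣V∣≤ , _ = ambiguous-points α δ
              β , β∉ = ∣p∣<n⇒∃∉ (U ∪ V) (≤-<-trans
                (≤-trans (∣p∪q∣≤∣p∣+∣q∣ U V) (+-mono-≤ ∣U∣≤ ∣V∣≤))
                (subst (_< n) (double c (k ∸ 1)) small))
          in β , unambiguous⇒ (β∉ ∘ x∈p∪q⁺ ∘ inj₁) , unambiguous⇒ (β∉ ∘ x∈p∪q⁺ ∘ inj₂)
          where
          double : ∀ c k → 2 * c * k ≡ k * c + k * c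
          double = solve-∀

      one-point-extension-regular : ∀ α → IsOneRegular (pointExtension X ⁅ α ⁆)
      one-point-extension-regular α =
        let β , β⇒ = regular-point α in β , ⇒-all⇒regular (pointExtension X ⁅ α ⁆) β⇒

      two-point-base : ∀ α → ∃ λ β → IsBase X (⁅ α ⁆ ∪ ⁅ β ⁆)
      two-point-base α =
        let β , β⇒ = regular-point α
            A = ⁅ α ⁆ ∪ ⁅ β ⁆
            Z = pointExtension X A
            open IsPointExtension (pointExtension-isPointExtension X A)
            -- Fixing `β` as well only refines the extension at `α`, so `β ⇒ γ` persists in `Z`.
            Y≼Z = IsPointExtension.smallest (pointExtension-isPointExtension X ⁅ α ⁆) Z extends
                    (λ γ → fixes γ ∘ x∈p∪q⁺ ∘ inj₁)
        in β , ⇒-all⇒complete Z fixes (x∈p∪q⁺ (inj₂ (x∈⁅x⁆ β)))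
                 (λ γ e → β⇒ γ (≼⇒refines (pointExtension X ⁅ α ⁆) Z Y≼Z e))

      baseNumber≤2 : Fin n → baseNumber X ≤ 2
      baseNumber≤2 α = let β , base = two-point-base α in begin
        baseNumber X             ≤⟨ IsBaseNumber.minimal (baseNumber-isBaseNumber X) _ base ⟩
        -- The two points may coincide, hence only an upper bound here.
        ∣ ⁅ α ⁆ ∪ ⁅ β ⁆ ∣        ≤⟨ ∣p∪q∣≤∣p∣+∣q∣ ⁅ α ⁆ ⁅ β ⁆ ⟩
        ∣ ⁅ α ⁆ ∣ + ∣ ⁅ β ⁆ ∣    ≡⟨ cong₂ _+_ (∣⁅x⁆∣≡1 α) (∣⁅x⁆∣≡1 β) ⟩
        2                        ∎
        where open ≤-Reasoning

theorem3p1 : ∀ (n : ℕ) (X : CoherentConfiguration n) (hom : IsHomogeneous X) →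
    2 * indistinguishingNumber X hom * (maxValency X ∸ 1) < n →
    (∀ α → IsOneRegular (pointExtension X ⁅ α ⁆)) × baseNumber X ≤ 2
-- The strict inequality excludes `n = 0`; otherwise `zero` supplies the first base point.
theorem3p1 zero    X hom ()
theorem3p1 (suc n) X hom small = one-point-extension-regular X hom small , baseNumber≤2 X hom small zero
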